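{- Let $E^{\mathrm{ce}},F^{\mathrm{ce}}$ be equivalence relations on $\omega$ extending $=^{\mathrm{ce}}$ such that $E^{\mathrm{ce}}<_{\mathrm{Learn}}F^{\mathrm{ce}}$. Then there is a family $\mathfrak{K}$ of nonempty c.e. sets such that $\mathfrak{K}$ is not $E^{\mathrm{ce}}$-learnable and all indices of sets in $\mathfrak{K}$ belong to a single $F^{\mathrm{ce}}$-equivalence class.
   Context: Fix a standard (acceptable) enumeration $(\varphi_e)_{e\in\omega}$ of the partial computable functions and let $W_e=\operatorname{dom}(\varphi_e)$. Write $e=^{\mathrm{ce}}e'$ iff $W_e=W_{e'}$. Equivalence relations on $\omega$ extending $=^{\mathrm{ce}}$ are arbitrary (no definability or effectivity is assumed). An enumeration of a set $A$ is a surjection $\mu:\omega\to A$; $\mu[s]$ denotes the finite string $\mu(0),\dots,\mu(s-1)$. A learner is an arbitrary function $\mathbf{M}:\omega^{<\omega}\to\omega$ (no effectivity is assumed). A family $\mathfrak{K}$ of nonempty c.e. sets is $E^{\mathrm{ce}}$-learnable if there is a learner $\mathbf{M}$ such that for every $e$ with $W_e\in\mathfrak{K}$ and every enumeration $\mu$ of $W_e$ there is $i\in\omega$ with $i\mathrel{E^{\mathrm{ce}}}e$ and $\mathbf{M}(\mu[s])=i$ for all sufficiently large $s$. $E^{\mathrm{ce}}\leq_{\mathrm{Learn}}F^{\mathrm{ce}}$ means that every $E^{\mathrm{ce}}$-learnable family of nonempty c.e. sets is also $F^{\mathrm{ce}}$-learnable; $E^{\mathrm{ce}}<_{\mathrm{Learn}}F^{\mathrm{ce}}$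 means $E^{\mathrm{ce}}\leq_{\mathrm{Learn}}F^{\mathrm{ce}}$ and $F^{\mathrm{ce}}\not\leq_{\mathrm{Learn}}E^{\mathrm{ce}}$. An index of a c.e. set $A$ is any $e$ with $W_e=A$. -}

module Defs where

open import Axiom.ExcludedMiddle using (ExcludedMiddle)
open import Data.Fin.Base using (Fin)
open import Data.List.Base using (List; applyUpTo)
open import Data.Nat.Base using (ℕ; zero; suc; _<_; _≤_)
open import Data.Product.Base using (∃-syntax; Σ-syntax; _×_)
open import Data.Vec.Base using (Vec; []; _∷_; lookup)
open import Data.Vec.Relation.Binary.Pointwise.Inductive using (Pointwise)
open import Function.Bundles using (_⇔_)
open import Level using (0ℓ) renaming (suc to lsuc)
open import Relation.Binary.Core using (Rel; _⇒_)
open import Relation.Binary.Definitions using (_Respects_)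
open import Relation.Binary.PropositionalEquality.Core using (_≡_)
open import Relation.Binary.Structures using (IsEquivalence)
open import Relation.Nullary.Negation.Core using (¬_)
open import Relation.Unary using (Pred; _∈_; _≐_; Satisfiable)

-- The mathematics is classical, so excluded middle is available as an
-- explicit hypothesis.  It is needed for types in Set₁ because families of
-- sets live there; by lifting it also covers types in Set.
Classical : Set₂
Classical = ExcludedMiddle (lsuc 0ℓ)

-- Kleene's partial recursive functions of n arguments.
data Rec : ℕ → Set where
  zer  : ∀ {n} → Rec n
  succ : Rec 1
  proj : ∀ {n} → Fin n → Rec n
  comp : ∀ {n m} → Rec m → Vec (Rec n) m → Rec n
  prim : ∀ {n} → Rec n → Rec (suc (suc n)) → Rec (suc n)
  mu   : ∀ {n} → Rec (suc n) → Rec n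

infix 4 _[_]⇓_

-- f [ xs ]⇓ y : the computation of f on xs halts with value y.
data _[_]⇓_ : ∀ {n} → Rec n → Vec ℕ n → ℕ → Set where
  zer⇓   : ∀ {n} {xs : Vec ℕ n} → zer [ xs ]⇓ 0
  succ⇓  : ∀ {x} → succ [ x ∷ [] ]⇓ suc x
  proj⇓  : ∀ {n} {i : Fin n} {xs} → proj i [ xs ]⇓ lookup xs i
  comp⇓  : ∀ {n m} {f : Rec m} {gs : Vec (Rec n) m} {xs ys z} →
           Pointwise (λ g y → g [ xs ]⇓ y) gs ys →
           f [ ys ]⇓ z →
           comp f gs [ xs ]⇓ z
  prim₀⇓ : ∀ {n} {f : Rec n} {g xs y} →
           f [ xs ]⇓ y →
           prim f g [ zero ∷ xs ]⇓ y
  primₛ⇓ : ∀ {n} {f : Rec n} {g xs k r y} →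
           prim f g [ k ∷ xs ]⇓ r →
           g [ k ∷ r ∷ xs ]⇓ y →
           prim f g [ suc k ∷ xs ]⇓ y
  mu⇓    : ∀ {n} {f : Rec (suc n)} {xs y} →
           f [ y ∷ xs ]⇓ 0 →
           (∀ z → z < y → ∃[ v ] f [ z ∷ xs ]⇓ suc v) →
           mu f [ xs ]⇓ y

-- An acceptable enumeration (φₑ) of the unary partial computable functions,
-- given by graphs: φ e x y means that φₑ(x) is defined and equal to y.
record AcceptableEnumeration : Set₁ where
  field
    φ         : ℕ → ℕ → ℕ → Set
    universal : ∃[ u ] ∀ e x y → φ e x y ⇔ u [ e ∷ x ∷ [] ]⇓ y
    complete  : (p : Rec 1) → ∃[ e ] ∀ x y → φ e x y ⇔ p [ x ∷ [] ]⇓ y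
    -- The s-m-n property, where s computes the total function f.
    smn       : (ψ : Rec 2) →
                ∃[ s ] Σ[ f ∈ (ℕ → ℕ) ]
                  (∀ e → s [ e ∷ [] ]⇓ f e) ×
                  (∀ e x y → φ (f e) x y ⇔ ψ [ e ∷ x ∷ [] ]⇓ y)

record _Enumerates_ (μ : ℕ → ℕ) (A : Pred ℕ 0ℓ) : Set where
  field
    into : ∀ s → μ s ∈ A
    onto : ∀ {x} → x ∈ A → ∃[ s ] μ s ≡ x

-- μ ↾ s is the finite string μ(0), …, μ(s-1).
_↾_ : (ℕ → ℕ) → ℕ → List ℕ
μ ↾ s = applyUpTo μ s

Learner : Set
Learner = List ℕ → ℕ

_ConvergesOn_To_ : Learner → (ℕ → ℕ) → ℕ → Set
M ConvergesOn μ To i = ∃[ s₀ ] ∀ s → s₀ ≤ s → M (μ ↾ s) ≡ i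

module Learning (𝓔 : AcceptableEnumeration) where
  open AcceptableEnumeration 𝓔

  W : ℕ → Pred ℕ 0ℓ
  W e x = ∃[ y ] φ e x y

  _=ce_ : Rel ℕ 0ℓ
  e =ce e′ = W e ≐ W e′

  _IndexOf_ : ℕ → Pred ℕ 0ℓ → Set
  e IndexOf A = W e ≐ A

  -- Sets of numbers are predicates, identified up to ≐; hence a family of
  -- sets must be closed under ≐.
  record Family : Set₁ where
    field
      Member   : Pred (Pred ℕ 0ℓ) 0ℓ
      respects : Member Respects _≐_
      nonempty : ∀ {A} → Member A → Satisfiable A
      ce       : ∀ {A} → Member A → ∃[ e ] e IndexOf A

  open Family public using (Member)

  Learns : Rel ℕ 0ℓ → Learner → Family → Set
  Learns E M 𝔎 = ∀ e → Member 𝔎 (W e) →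
                 ∀ μ → μ Enumerates W e →
                 ∃[ i ] E i e × M ConvergesOn μ To i

  Learnable : Rel ℕ 0ℓ → Family → Set
  Learnable E 𝔎 = ∃[ M ] Learns E M 𝔎

  _≤Learn_ : Rel ℕ 0ℓ → Rel ℕ 0ℓ → Set₁
  E ≤Learn F = ∀ 𝔎 → Learnable E 𝔎 → Learnable F 𝔎

  _<Learn_ : Rel ℕ 0ℓ → Rel ℕ 0ℓ → Set₁
  E <Learn F = E ≤Learn F × ¬ (F ≤Learn E)

  -- An equivalence relation on indices extending =ce.
  record IsExtension (E : Rel ℕ 0ℓ) : Set where
    field
      isEquivalence : IsEquivalence E
      extends       : _=ce_ ⇒ E

  -- The F-classes are the sets { e ∣ F e c }, for c a number.
  IndicesInSingleClass : Rel ℕ 0ℓ → Family → Set₁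
  IndicesInSingleClass F 𝔎 =
    ∃[ c ] ∀ A → Member 𝔎 A → ∀ e → e IndexOf A → F e c

{-# OPTIONS --safe #-}

-- A family is E-learnable iff each of its members W e has a finite subset D,
-- an E-telltale, such that every member B with D ⊆ B ⊆ W e has E-equivalent
-- indices.  A locking string gives D; conversely one conjectures the least
-- index compatible with the telltales.  So if 𝔎 is F- but not E-learnable, some
-- W e in 𝔎 has an F-telltale D but no E-telltale, and the members B of 𝔎
-- with D ⊆ B ⊆ W e form the required family.
module Submission where

open import Defs
open import Axiom.DoubleNegationElimination using (em⇒dne)
open import Axiom.ExcludedMiddle using (ExcludedMiddle)
open import Data.Empty using (⊥)
open import Data.List.Base using (List; []; _∷_; _++_; _∷ʳ_; length; applyUpTo)
import Data.List.Membership.Propositional as List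
open import Data.List.Membership.Propositional.Properties
  using (∈-applyUpTo⁺; ∈-applyUpTo⁻)
open import Data.List.NonEmpty.Base using (List⁺; _∷_; head; tail; toList)
open import Data.List.Properties using (++-assoc; length-++; ∷ʳ-++; applyUpTo-∷ʳ)
open import Data.List.Relation.Unary.All as All using (All; []; _∷_)
open import Data.List.Relation.Unary.All.Properties
  using (++⁺; ++⁻; ∷ʳ⁺; applyUpTo⁺₁; applyUpTo⁻)
open import Data.List.Relation.Unary.Any using (here)
open import Data.List.Relation.Unary.Any.Properties as Any using ()
open import Data.Nat.Base using (ℕ; zero; suc; _+_; _≤_; _<_; _⊔_; z≤n; s≤s)
open import Data.Nat.Induction using (<-rec)
open import Data.Nat.Properties
  using (≤-refl; ≤-trans; n≤1+n; n<1+n; m<n⇒m<1+n; m<1+n⇒m<n∨m≡n; <-cmp;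
         m≤m⊔n; m≤n⊔m; +-comm; +-mono-≤; module ≤-Reasoning)
open import Data.Product.Base using (∃-syntax; ∃; _×_; _,_; proj₁; proj₂)
open import Data.Sum.Base using (inj₁; inj₂)
open import Function.Base using (_∘_)
open import Level using (0ℓ; lift; lower; Lift) renaming (suc to lsuc)
open import Relation.Binary.Core using (Rel)
open import Relation.Binary.Definitions using (tri<; tri≈; tri>)
open import Relation.Binary.PropositionalEquality
  using (_≡_; _≗_; refl; sym; trans; cong; cong₂; subst)
open import Relation.Binary.Structures using (IsEquivalence)
open import Relation.Nullary.Decidable using (yes; no; map′)
open import Relation.Nullary.Negation.Core using (¬_; contradiction)
open import Relation.Unary using (Pred; _⊆_; Satisfiable)

private variable
  X : Set
  P Q : Pred ℕ 0ℓ

lower-em : ∀ {a} b → ExcludedMiddle (a Level.⊔ b) → ExcludedMiddle a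
lower-em b em {P} = map′ lower lift (em {Lift b P})

-- Infinite sequences as concatenations of finite blocks.

applyUpTo-cong : {f g : ℕ → X} → f ≗ g → applyUpTo f ≗ applyUpTo g
applyUpTo-cong f≗g zero    = refl
applyUpTo-cong f≗g (suc n) = cong₂ _∷_ (f≗g 0) (applyUpTo-cong (f≗g ∘ suc) n)

-- Blocks are nonempty lists so that the recursion consumes one position per call.
concat∞ : List X → (ℕ → List⁺ X) → ℕ → X
concat∞ []       β zero    = head (β 0)
concat∞ []       β (suc n) = concat∞ (tail (β 0)) (β ∘ suc) n
concat∞ (x ∷ xs) β zero    = x
concat∞ (x ∷ xs) β (suc n) = concat∞ xs β n

concat∞-prefix : ∀ (xs : List X) β → applyUpTo (concat∞ xs β) (length xs) ≡ xs
concat∞-prefix []       β = refl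
concat∞-prefix (x ∷ xs) β = cong (x ∷_) (concat∞-prefix xs β)

concat∞-step : ∀ (xs : List X) β →
               concat∞ xs β ≗ concat∞ (xs ++ toList (β 0)) (β ∘ suc)
concat∞-step []       β zero    = refl
concat∞-step []       β (suc n) = refl
concat∞-step (x ∷ xs) β zero    = refl
concat∞-step (x ∷ xs) β (suc n) = concat∞-step xs β n

-- Absorbing the first block into the prefix leaves the sequence unchanged, so the claim for `suc k`
-- is the claim for `k` about the shifted data.
concat∞-stage : ∀ (σ : ℕ → List X) β → (∀ k → σ (suc k) ≡ σ k ++ toList (β k)) →
                ∀ k → applyUpTo (concat∞ (σ 0) β) (length (σ k)) ≡ σ k
concat∞-stage σ β step zero    = concat∞-prefix (σ 0) β
concat∞-stage σ β step (suc k) = trans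
  (applyUpTo-cong
    (λ n → trans (concat∞-step (σ 0) β n)
                 (cong (λ xs → concat∞ xs (β ∘ suc) n) (sym (step 0))))
    (length (σ (suc k))))
  (concat∞-stage (σ ∘ suc) (β ∘ suc) (step ∘ suc) k)

stage-length : ∀ (σ : ℕ → List X) (β : ℕ → List⁺ X) →
               (∀ k → σ (suc k) ≡ σ k ++ toList (β k)) →
               ∀ k → k ≤ length (σ k)
stage-length σ β step zero    = z≤n
stage-length σ β step (suc k) = begin
  suc k                                ≡⟨ +-comm 1 k ⟩
  k + 1                                ≤⟨ +-mono-≤ (stage-length σ β step k) (s≤s z≤n) ⟩
  length (σ k) + length (toList (β k)) ≡⟨ length-++ (σ k) ⟨
  length (σ k ++ toList (β k))         ≡⟨ cong length (step k) ⟨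
  length (σ (suc k))                   ∎
  where open ≤-Reasoning

open _Enumerates_

-- Block `k` begins with `a k`, so everything listed by `a` is listed again, while the tails `τ k`
-- stay free to steer a learner.
concat∞-enumerates :
  ∀ {a} → a Enumerates P → ∀ (σ τ : ℕ → List ℕ) →
  (∀ k → σ (suc k) ≡ σ k ++ a k ∷ τ k) →
  (∀ k → All P (σ k)) → concat∞ (σ 0) (λ k → a k ∷ τ k) Enumerates P
concat∞-enumerates {P} {a} a↠P σ τ step σ⊆P = record { into = μ∈P ; onto = P⊆μ }
  where
  β : ℕ → List⁺ ℕ
  β k = a k ∷ τ k

  μ : ℕ → ℕ
  μ = concat∞ (σ 0) β

  stage : ∀ k → μ ↾ length (σ k) ≡ σ k
  stage = concat∞-stage σ β step

  μ∈P : ∀ s → P (μ s)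
  -- Stage `suc s` has more than `s` entries, so position `s` lies inside it.
  μ∈P s = applyUpTo⁻ μ _ (subst (All P) (sym (stage (suc s))) (σ⊆P (suc s)))
            (stage-length σ β step (suc s))

  P⊆μ : ∀ {x} → P x → ∃[ s ] μ s ≡ x
  P⊆μ x∈P with onto a↠P x∈P
  ... | k , refl with ∈-applyUpTo⁻ μ (subst (a k List.∈_) (sym (stage (suc k)))
                        (subst (a k List.∈_) (sym (step k))
                          (Any.++⁺ʳ (σ k) (here refl))))
  ...   | s , _ , x≡μs = s , sym x≡μs

-- Properties that hold from some stage on.

Eventually : Pred ℕ 0ℓ → Set
Eventually P = ∃[ s₀ ] ∀ s → s₀ ≤ s → P s

eventually-map : P ⊆ Q → Eventually P → Eventually Q
eventually-map P⊆Q (s₀ , p) = s₀ , λ s s₀≤s → P⊆Q (p s s₀≤s)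

eventually-× : Eventually P → Eventually Q → Eventually (λ s → P s × Q s)
eventually-× (s₀ , p) (s₁ , q) = s₀ ⊔ s₁ , λ s ≤s →
  p s (≤-trans (m≤m⊔n s₀ s₁) ≤s) , q s (≤-trans (m≤n⊔m s₀ s₁) ≤s)

eventually-∀< : ∀ {R : ℕ → Pred ℕ 0ℓ} n → (∀ m → m < n → Eventually (R m)) →
                Eventually (λ s → ∀ m → m < n → R m s)
eventually-∀< zero    ev = 0 , λ _ _ _ ()
eventually-∀< {R} (suc n) ev = eventually-map extend
  (eventually-× (eventually-∀< n (λ m m<n → ev m (m<n⇒m<1+n m<n)))
                (ev n (n<1+n n)))
  where
  extend : ∀ {s} → (∀ m → m < n → R m s) × R n s → ∀ m → m < suc n → R m s
  extend (below , at) m m<1+n with m<1+n⇒m<n∨m≡n m<1+n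
  ... | inj₁ m<n  = below m m<n
  ... | inj₂ refl = at

eventually-⊆ : ∀ {μ} → μ Enumerates P → ∀ {xs} → All P xs →
               Eventually (λ s → All (List._∈ μ ↾ s) xs)
eventually-⊆ μ↠P []         = 0 , λ _ _ → []
eventually-⊆ {μ = μ} μ↠P (x∈P ∷ xs⊆P) with onto μ↠P x∈P
... | t , refl = eventually-map (λ (h , hs) → h ∷ hs)
  (eventually-× (suc t , λ s t<s → ∈-applyUpTo⁺ μ t<s) (eventually-⊆ μ↠P xs⊆P))

Least : Pred ℕ 0ℓ → Pred ℕ 0ℓ
Least P n = P n × (∀ m → m < n → ¬ P m)

least-unique : ∀ {m n} → Least P m → Least P n → m ≡ n
least-unique {m = m} {n} (Pm , <m) (Pn , <n) with <-cmp m n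
... | tri< m<n _ _ = contradiction Pm (<n m m<n)
... | tri≈ _ m≡n _ = m≡n
... | tri> _ _ n<m = contradiction Pn (<m n n<m)

-- Telltales and the subfamilies they cut out.

module Telltales (𝓔 : AcceptableEnumeration) where
  open Learning 𝓔

  Telltale : Rel ℕ 0ℓ → Family → ℕ → List ℕ → Set
  Telltale E 𝔎 e D = All (W e) D ×
    (∀ e′ → Member 𝔎 (W e′) → All (W e′) D → W e′ ⊆ W e → E e′ e)

  between : Family → List ℕ → Pred ℕ 0ℓ → Family
  between 𝔎 D A = record
    { Member   = λ B → Member 𝔎 B × All B D × B ⊆ A
    ; respects = λ B≐C@(B⊆C , C⊆B) (B∈𝔎 , D⊆B , B⊆A) →
        Family.respects 𝔎 B≐C B∈𝔎 , All.map B⊆C D⊆B , B⊆A ∘ C⊆B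
    ; nonempty = Family.nonempty 𝔎 ∘ proj₁
    ; ce       = Family.ce 𝔎 ∘ proj₁
    }

  -- A member of `𝔎` inside `W e` that contains `D ++ D′` already lies in the subfamily, where `D′`
  -- decides.
  telltale-between : ∀ {E 𝔎 e D D′} → All (W e) D →
                     Telltale E (between 𝔎 D (W e)) e D′ → Telltale E 𝔎 e (D ++ D′)
  telltale-between {D = D} D⊆ (D′⊆ , tell) = ++⁺ D⊆ D′⊆ , λ e′ e′∈𝔎 D++D′⊆ ⊆ →
    let D⊆′ , D′⊆′ = ++⁻ D D++D′⊆ in tell e′ (e′∈𝔎 , D⊆′ , ⊆) D′⊆′ ⊆

  between-single-class : ∀ {F} 𝔎 {e D} → Telltale F 𝔎 e D →
                         IndicesInSingleClass F (between 𝔎 D (W e))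
  between-single-class 𝔎 {e} (_ , tell) = e , λ A (A∈𝔎 , D⊆A , A⊆) e′ (⊆A , A⊆′) →
    tell e′ (Family.respects 𝔎 (A⊆′ , ⊆A) A∈𝔎) (All.map A⊆′ D⊆A) (A⊆ ∘ ⊆A)

  -- The stages `σ k` are prefixes, of unbounded length, of a single enumeration of `W e`;
  -- convergence along it can therefore be read off at the stages alone.
  learns-stages :
    ∀ {E} M 𝔎 → Learns E M 𝔎 → ∀ {e} → Member 𝔎 (W e) →
    ∀ {a} → a Enumerates W e → ∀ (σ τ : ℕ → List ℕ) →
    (∀ k → σ (suc k) ≡ σ k ++ a k ∷ τ k) →
    (∀ k → All (W e) (σ k)) →
    ∃[ i ] E i e × Eventually (λ k → M (σ k) ≡ i)
  learns-stages M 𝔎 learns {e} e∈𝔎 {a} a↠ σ τ step σ⊆ =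
    let i , Eie , s₀ , conv = learns e e∈𝔎 _ (concat∞-enumerates a↠ σ τ step σ⊆)
    in i , Eie , s₀ , λ k s₀≤k → trans
         (cong M (sym (concat∞-stage σ β step k)))
         (conv _ (≤-trans s₀≤k (stage-length σ β step k)))
    where
    β : ℕ → List⁺ ℕ
    β k = a k ∷ τ k

  -- Only constancy above `ρ` is demanded; that `v` is a correct conjecture is the content of
  -- `locked-value`.
  Locking : Learner → Pred ℕ 0ℓ → List ℕ → ℕ → Set
  Locking M P ρ v = All P ρ × (∀ τ → All P τ → M (ρ ++ τ) ≡ v)

-- Least elements and enumerations by excluded middle.

module _ (em : ExcludedMiddle 0ℓ) where

  private
    dne : ∀ {A : Set} → ¬ ¬ A → A
    dne = em⇒dne em

  least : Satisfiable P → Satisfiable (Least P)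
  least {P} (n , Pn) = <-rec (λ n → P n → Satisfiable (Least P)) go n Pn
    where
    go : ∀ n → (∀ {m} → m < n → P m → Satisfiable (Least P)) →
         P n → Satisfiable (Least P)
    go n rec Pn with em {∃[ m ] m < n × P m}
    ... | yes (m , m<n , Pm) = rec m<n Pm
    ... | no none            = n , Pn , λ m m<n Pm → none (m , m<n , Pm)

  -- A learner must answer on every string; the default 0 covers strings for which no candidate
  -- exists.
  leastOr0 : Pred ℕ 0ℓ → ℕ
  leastOr0 P with em {Satisfiable (Least P)}
  ... | yes (n , _) = n
  ... | no _        = 0

  leastOr0-≡ : ∀ {n} → Least P n → leastOr0 P ≡ n
  leastOr0-≡ {P} {n} n-least with em {Satisfiable (Least P)}
  ... | yes (_ , m-least) = least-unique m-least n-least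
  ... | no none           = contradiction (n , n-least) none

  enumerate : Satisfiable P → ∃[ a ] a Enumerates P
  enumerate {P} (x₀ , x₀∈P) = a , record { into = a∈P ; onto = λ x∈P → _ , a-fixes x∈P }
    where
    a : ℕ → ℕ
    a n with em {P n}
    ... | yes _ = n
    ... | no _  = x₀

    a∈P : ∀ n → P (a n)
    a∈P n with em {P n}
    ... | yes n∈P = n∈P
    ... | no _    = x₀∈P

    a-fixes : ∀ {x} → P x → a x ≡ x
    a-fixes {x} x∈P with em {P x}
    ... | yes _  = refl
    ... | no x∉P = contradiction x∈P x∉P

  -- An element of `P` outside `Q`, once listed, stays in every later prefix.
  eventually-⊈ : ∀ {μ} → μ Enumerates P → ¬ (P ⊆ Q) →
                 Eventually (λ s → ¬ All Q (μ ↾ s))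
  eventually-⊈ {P} {Q} {μ} μ↠P P⊈Q with
    dne {∃[ t ] ¬ Q (μ t)} (λ none → P⊈Q (λ x∈P →
      let t , μt≡x = onto μ↠P x∈P
      in subst Q μt≡x (dne (λ μt∉Q → none (t , μt∉Q)))))
  ... | t , μt∉Q = suc t , λ s t<s μ↾s⊆Q → μt∉Q (applyUpTo⁻ μ s μ↾s⊆Q t<s)

  -- Learnability and telltales.

  module _ (𝓔 : AcceptableEnumeration) where
    open Learning 𝓔
    open Telltales 𝓔

    -- Without a locking string, the learner can be forced to change its mind
    -- while every element still gets enumerated.
    locking : ∀ {E} M 𝔎 → Learns E M 𝔎 → ∀ {e} → Member 𝔎 (W e) →
              ∃[ ρ ] ∃[ v ] Locking M (W e) ρ v
    locking M 𝔎 learns {e} e∈𝔎 = dne unlocked-absurd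
      where
      module _ (unlocked : ¬ (∃[ ρ ] ∃[ v ] Locking M (W e) ρ v)) where
        A : Pred ℕ 0ℓ
        A = W e

        change : ∀ {ρ} → All A ρ → ∀ v → ∃[ τ ] All A τ × ¬ M (ρ ++ τ) ≡ v
        change {ρ} ρ⊆A v = dne λ none → unlocked (ρ , v , ρ⊆A , λ τ τ⊆A →
          dne λ ≢v → none (τ , τ⊆A , ≢v))

        enum = enumerate (Family.nonempty 𝔎 e∈𝔎)
        a   = proj₁ enum
        a↠A = proj₂ enum

        -- The value to avoid is `M σ`, taken before `a k` is appended, so that consecutive stages
        -- receive different conjectures.
        extension : ∀ k {σ} → All A σ → ∃[ τ ] All A τ × ¬ M (σ ∷ʳ a k ++ τ) ≡ M σ
        extension k {σ} σ⊆A = change (∷ʳ⁺ σ⊆A (into a↠A k)) (M σ)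

        stage : ℕ → ∃ (All A)
        stage zero    = [] , []
        stage (suc k) =
          let σ , σ⊆A     = stage k
              τ , τ⊆A , _ = extension k σ⊆A
          in σ ++ a k ∷ τ , ++⁺ σ⊆A (into a↠A k ∷ τ⊆A)

        σ τ : ℕ → List ℕ
        σ k = proj₁ (stage k)
        τ k = proj₁ (extension k (proj₂ (stage k)))

        changes : ∀ k → ¬ M (σ (suc k)) ≡ M (σ k)
        changes k eq = proj₂ (proj₂ (extension k (proj₂ (stage k))))
          (trans (cong M (∷ʳ-++ (σ k) (a k) (τ k))) eq)

        unlocked-absurd : ⊥
        unlocked-absurd =
          let _ , _ , k , conv = learns-stages M 𝔎 learns e∈𝔎 a↠A σ τ (λ _ → refl)
                                   (λ k → proj₂ (stage k))
          in changes k (trans (conv (suc k) (n≤1+n k)) (sym (conv k ≤-refl)))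

    -- Enumerate `W e` with `ρ` put in front: each stage extends `ρ` by elements of `P`, so `M`
    -- keeps answering `v`, and its limit must be correct for `e`.
    locked-value : ∀ {E} M 𝔎 → Learns E M 𝔎 → ∀ {P ρ v} → Locking M P ρ v →
                   ∀ e → Member 𝔎 (W e) → All (W e) ρ → W e ⊆ P → E v e
    locked-value {E} M 𝔎 learns {P} {ρ} {v} (_ , locked) e e∈𝔎 ρ⊆ ⊆P =
      let i , Eie , k , conv = learns-stages M 𝔎 learns e∈𝔎 a↠ σ (λ _ → []) step σ⊆
      in subst (λ j → E j e) (trans (sym (conv k ≤-refl)) (M∘σ≡v k)) Eie
      where
      enum = enumerate (Family.nonempty 𝔎 e∈𝔎)
      a  = proj₁ enum
      a↠ = proj₂ enum

      σ : ℕ → List ℕ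
      σ k = ρ ++ a ↾ k

      step : ∀ k → σ (suc k) ≡ σ k ++ a k ∷ []
      step k = sym (trans (++-assoc ρ (a ↾ k) _) (cong (ρ ++_) (applyUpTo-∷ʳ a k)))

      a↾⊆ : ∀ k → All (W e) (a ↾ k)
      a↾⊆ k = applyUpTo⁺₁ a k (λ {i} _ → into a↠ i)

      σ⊆ : ∀ k → All (W e) (σ k)
      σ⊆ k = ++⁺ ρ⊆ (a↾⊆ k)

      M∘σ≡v : ∀ k → M (σ k) ≡ v
      M∘σ≡v k = locked (a ↾ k) (All.map ⊆P (a↾⊆ k))

    -- The locking string itself is the telltale: `v` is equivalent to `e` and to the index of any
    -- member lying between `ρ` and `W e`.
    learnable⇒telltale : ∀ {E 𝔎} → IsExtension E → Learnable E 𝔎 →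
                         ∀ {e} → Member 𝔎 (W e) → ∃ (Telltale E 𝔎 e)
    learnable⇒telltale {E} {𝔎} ext (M , learns) {e} e∈𝔎 =
      let ρ , v , lock@(ρ⊆ , _) = locking M 𝔎 learns e∈𝔎
          value = locked-value M 𝔎 learns lock
      in ρ , ρ⊆ , λ e′ e′∈𝔎 ρ⊆′ ⊆ → E.trans (E.sym (value e′ e′∈𝔎 ρ⊆′ ⊆))
                                            (value e e∈𝔎 ρ⊆ (λ x → x))
      where module E = IsEquivalence (IsExtension.isEquivalence ext)

    telltales⇒learnable :
      ∀ {E 𝔎} → IsExtension E → (D : ℕ → List ℕ) →
      (∀ e → Member 𝔎 (W e) → Telltale E 𝔎 e (D e)) → Learnable E 𝔎
    telltales⇒learnable {E} {𝔎} ext D telltale = M , learns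
      where
      module E = IsEquivalence (IsExtension.isEquivalence ext)

      Consistent : List ℕ → Pred ℕ 0ℓ
      Consistent σ e = Member 𝔎 (W e) × All (List._∈ σ) (D e) × All (W e) σ

      M : Learner
      M σ = leastOr0 (Consistent σ)

      -- The limit form of `Consistent` when the data exhaust `A`; the learner converges to its
      -- least solution.
      Between : Pred ℕ 0ℓ → Pred ℕ 0ℓ
      Between A e = Member 𝔎 (W e) × All A (D e) × A ⊆ W e

      learns : Learns E M 𝔎
      learns e e∈𝔎 μ μ↠ with
        least {Between (W e)} (e , e∈𝔎 , proj₁ (telltale e e∈𝔎) , λ x∈ → x∈)
      ... | i , (i∈𝔎 , Di⊆ , ⊆Wi) , minimal =
        -- `W e` lies between `D i` and `W i`, so the telltale of `i`, not that of `e`, gives the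
        -- equivalence.
        i , E.sym (proj₂ (telltale i i∈𝔎) e e∈𝔎 Di⊆ ⊆Wi) ,
        eventually-map (λ (below , consistent-i) → leastOr0-≡ (consistent-i , below))
          (eventually-× (eventually-∀< i refuted) consistent)
        where
        consistent : Eventually (λ s → Consistent (μ ↾ s) i)
        consistent = eventually-map
          (λ {s} Di⊆μ → i∈𝔎 , Di⊆μ , applyUpTo⁺₁ μ s (λ {t} _ → ⊆Wi (into μ↠ t)))
          (eventually-⊆ μ↠ Di⊆)

        refuted : ∀ m → m < i → Eventually (λ s → ¬ Consistent (μ ↾ s) m)
        refuted m m<i with em {Member 𝔎 (W m)} | em {All (W e) (D m)}
        ... | no m∉𝔎  | _       = 0 , λ _ _ (m∈𝔎 , _) → m∉𝔎 m∈𝔎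
        -- The data never leave `W e`, so they never cover `D m`.
        ... | yes _   | no Dm⊈  = 0 , λ s _ (_ , Dm⊆μ , _) → Dm⊈
          (All.map (λ x∈ → All.lookup (applyUpTo⁺₁ μ s (λ {t} _ → into μ↠ t)) x∈) Dm⊆μ)
        -- By minimality of `i`, some element of `W e` lies outside `W m`; its appearance rules out
        -- `m`.
        ... | yes m∈𝔎 | yes Dm⊆ = eventually-map (λ ⊈ (_ , _ , ⊆) → ⊈ ⊆)
          (eventually-⊈ μ↠ (λ ⊆Wm → minimal m m<i (m∈𝔎 , Dm⊆ , ⊆Wm)))

    -- Extracting the single-class family.

    no-telltale : ∀ {E 𝔎} → IsExtension E → ¬ Learnable E 𝔎 →
                  ∃[ e ] Member 𝔎 (W e) × ¬ ∃ (Telltale E 𝔎 e)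
    no-telltale {E} {𝔎} ext unlearnable = dne λ none →
      -- Membership sits under the existential so that `D` is defined at every index, with `[]`
      -- available for indices outside `𝔎`.
      let telltale : ∀ e → ∃[ D ] (Member 𝔎 (W e) → Telltale E 𝔎 e D)
          telltale e = dne λ noD → noD ([] , λ e∈𝔎 → contradiction
            (e , e∈𝔎 , λ (D , tt) → noD (D , λ _ → tt)) none)
      in unlearnable (telltales⇒learnable {𝔎 = 𝔎} ext
           (λ e → proj₁ (telltale e)) (λ e → proj₂ (telltale e)))

    -- `W e` belongs to the subfamily, so learnability would give it a telltale there, and adding
    -- `D` would make that a telltale in `𝔎`.
    between-unlearnable :
      ∀ {E} 𝔎 → IsExtension E → ∀ {e D} → Member 𝔎 (W e) →
      ¬ ∃ (Telltale E 𝔎 e) → All (W e) D → ¬ Learnable E (between 𝔎 D (W e))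
    between-unlearnable {E} 𝔎 ext {e} {D} e∈𝔎 none D⊆ learnable =
      none (D ++ proj₁ tell , telltale-between {E} {𝔎} {e} {D} {proj₁ tell} D⊆ (proj₂ tell))
      where
      tell : ∃ (Telltale E (between 𝔎 D (W e)) e)
      tell = learnable⇒telltale {E} {between 𝔎 D (W e)} ext learnable {e}
               (e∈𝔎 , D⊆ , λ x∈ → x∈)

    single-class-family :
      ∀ {E F} 𝔎 → IsExtension E → IsExtension F → Learnable F 𝔎 →
      ∃[ e ] Member 𝔎 (W e) × ¬ ∃ (Telltale E 𝔎 e) →
      ∃[ 𝔎′ ] (¬ Learnable E 𝔎′) × IndicesInSingleClass F 𝔎′
    single-class-family {E} {F} 𝔎 extE extF learnable (e , e∈𝔎 , none) =
      between 𝔎 D (W e)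
      , between-unlearnable 𝔎 extE e∈𝔎 none (proj₁ (proj₂ tell))
      , between-single-class 𝔎 (proj₂ tell)
      where
      tell : ∃ (Telltale F 𝔎 e)
      tell = learnable⇒telltale {F} {𝔎} extF learnable {e} e∈𝔎

      D : List ℕ
      D = proj₁ tell

theorem3p7 : Classical →
    (𝓔 : AcceptableEnumeration) → let open Learning 𝓔 in
    (E F : Rel ℕ 0ℓ) → IsExtension E → IsExtension F →
    E <Learn F →
    ∃[ 𝔎 ] (¬ Learnable E 𝔎) × IndicesInSingleClass F 𝔎
theorem3p7 em₁ 𝓔 E F extE extF (_ , F≰E) =
  let 𝔎 , F-learnable , E-unlearnable = separating
  in single-class-family em 𝓔 {E} {F} 𝔎 extE extF F-learnable
       (no-telltale em 𝓔 {E} {𝔎} extE E-unlearnable)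
  where
  open Learning 𝓔

  em : ExcludedMiddle 0ℓ
  em = lower-em (lsuc 0ℓ) em₁

  separating : ∃[ 𝔎 ] Learnable F 𝔎 × ¬ Learnable E 𝔎
  -- The existential over families lives in `Set₁`, hence `em₁`; learnability of one family lives in
  -- `Set`.
  separating = em⇒dne em₁ λ none → F≰E λ 𝔎 F-learnable →
    em⇒dne em λ E-unlearnable → none (𝔎 , F-learnable , E-unlearnable)
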